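{- Let $\mathcal G$ be the family of all graphs $G=(V\cup U,H\cup E)$ such that $(V,U,E)$ is a bipartite graph, $(V\cup U,E)$ is a forest, and: (i) each tree in $(V\cup U,E)$ has an even number of nodes of $V$; (ii) $H$ is a Hamiltonian cycle on the set of nodes $V$; (iii) $|V|<24$. Then every $G=(V\cup U,H\cup E)\in\mathcal G$ contains a second $V$-Hamiltonian cycle.
   Context: Graphs are finite and undirected; $(V,U,E)$ denotes a bipartite graph with (disjoint) sides $V$ and $U$ and edge set $E$; a cycle $H$ is identified with its edge set. For a graph $G$ and a subset $V$ of its nodes, a Hamiltonian cycle on $V$ is a simple cycle of $G$ whose node set is exactly $V$, and a $V$-Hamiltonian cycle is a simple cycle of $G$ whose node set contains $V$. $G$ contains a second $V$-Hamiltonian cycle if it contains a Hamiltonian cycle on $V$ and a $V$-Hamiltonian cycle that differ in at least one edge. The trees of a forest are its connected components. -}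

module Defs where

open import Data.Fin using (Fin)
open import Data.Fin.Properties using (_≟_)
open import Data.Fin.Subset using (Subset; _∈_; _∩_; _∪_; ⊤; ⊥; Nonempty; ∣_∣)
open import Data.List using (List; []; _∷_; _∷ʳ_; zip; length)
import Data.List.Membership.Propositional as List
import Data.List.Membership.DecPropositional as DecMembership
open import Data.List.Relation.Unary.All using (All; []; _∷_)
open import Data.List.Relation.Unary.AllPairs using ([]; _∷_)
open import Data.List.Relation.Unary.Any using (here; there)
open import Data.List.Relation.Unary.Unique.Propositional using (Unique)
open import Data.Nat using (ℕ; _≤_; s≤s)
open import Data.Nat.Divisibility using (_∣_)
open import Data.Product using (Σ-syntax; ∃-syntax; _×_; _,_)
open import Data.Product.Properties using (≡-dec)
open import Data.Sum using (_⊎_; inj₁; inj₂; swap; map; [_,_])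
open import Function.Bundles using (_⇔_)
open import Level using (0ℓ)
open import Relation.Binary.Construct.Closure.ReflexiveTransitive using (Star)
open import Relation.Binary.Core using (Rel)
open import Relation.Binary.Definitions using (Decidable)
open import Relation.Binary.PropositionalEquality using (_≡_; _≢_; refl)
open import Relation.Nullary using (¬_)
open import Relation.Nullary.Decidable using (_⊎-dec_)

-- Since the node set is fixed to Fin n, a Graph n also plays the role of an
-- edge set.
record Graph (n : ℕ) : Set₁ where
  field
    Adj        : Rel (Fin n) 0ℓ
    adj?       : Decidable Adj
    adj-sym    : ∀ {x y} → Adj x y → Adj y x
    adj-irrefl : ∀ {x} → ¬ Adj x x

open Graph public

infixr 6 _∪ᴳ_
infix 4 _⊆ᴳ_

_∪ᴳ_ : ∀ {n} → Graph n → Graph n → Graph n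
G ∪ᴳ G′ = record
  { Adj        = λ x y → Adj G x y ⊎ Adj G′ x y
  ; adj?       = λ x y → adj? G x y ⊎-dec adj? G′ x y
  ; adj-sym    = map (adj-sym G) (adj-sym G′)
  ; adj-irrefl = [ adj-irrefl G , adj-irrefl G′ ]
  }

_⊆ᴳ_ : ∀ {n} → Graph n → Graph n → Set
G ⊆ᴳ G′ = ∀ {x y} → Adj G x y → Adj G′ x y

-- A simple cycle, traversed from some starting node `first` through the
-- nodes of `rest` in order and back to `first`.  It is not tied to an ambient
-- graph: C is a cycle of G when cycleGraph C ⊆ᴳ G.
record Cycle (n : ℕ) : Set where
  field
    first    : Fin n
    rest     : List (Fin n)
    distinct : Unique (first ∷ rest)
    long     : 3 ≤ length (first ∷ rest)

  nodes : List (Fin n)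
  nodes = first ∷ rest

  steps : List (Fin n × Fin n)
  steps = zip nodes (rest ∷ʳ first)

open Cycle public

private
  no-loop : ∀ {n} {a z : Fin n} y ys → Unique (y ∷ ys) → All (z ≢_) (y ∷ ys) →
            ¬ ((a , a) List.∈ zip (y ∷ ys) (ys ∷ʳ z))
  no-loop y []        _                  (z≢y ∷ _) (here refl) = z≢y refl
  no-loop y (y′ ∷ ys) ((y≢y′ ∷ _) ∷ _)   _         (here refl) = y≢y′ refl
  no-loop y (y′ ∷ ys) (_ ∷ u)            (_ ∷ z≢)  (there p)   = no-loop y′ ys u z≢ p

  steps-irrefl : ∀ {n} (C : Cycle n) {a} → ¬ ((a , a) List.∈ steps C)
  steps-irrefl record { rest = [] ; long = s≤s () }
  steps-irrefl record { rest = y ∷ ys ; distinct = (x≢y ∷ _) ∷ _ } (here refl) = x≢y refl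
  steps-irrefl record { rest = y ∷ ys ; distinct = x≢ ∷ u }        (there p)   = no-loop y ys u x≢ p

cycleGraph : ∀ {n} → Cycle n → Graph n
cycleGraph {n} C = record
  { Adj        = λ x y → (x , y) List.∈ steps C ⊎ (y , x) List.∈ steps C
  ; adj?       = λ x y → ((x , y) ∈? steps C) ⊎-dec ((y , x) ∈? steps C)
  ; adj-sym    = swap
  ; adj-irrefl = [ steps-irrefl C , steps-irrefl C ]
  }
  where open DecMembership (≡-dec (_≟_ {n}) _≟_) using (_∈?_)

record IsBipartite {n} (V U : Subset n) (G : Graph n) : Set where
  field
    cover    : V ∪ U ≡ ⊤
    disjoint : V ∩ U ≡ ⊥
    across   : ∀ {x y} → Adj G x y → (x ∈ V × y ∈ U) ⊎ (x ∈ U × y ∈ V)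

IsForest : ∀ {n} → Graph n → Set
IsForest {n} G = ¬ (Σ[ C ∈ Cycle n ] cycleGraph C ⊆ᴳ G)

IsComponent : ∀ {n} → Graph n → Subset n → Set
IsComponent G T = Nonempty T × (∀ {x} → x ∈ T → ∀ y → y ∈ T ⇔ Star (Adj G) x y)

EvenlyMany : ∀ {n} → Subset n → Set
EvenlyMany S = 2 ∣ (∣ S ∣)

IsHamiltonianCycleOn : ∀ {n} → Graph n → Subset n → Cycle n → Set
IsHamiltonianCycleOn G V C = cycleGraph C ⊆ᴳ G × (∀ x → x List.∈ nodes C ⇔ x ∈ V)

-- V-Hamiltonian cycles, which may also visit nodes outside V.
IsSubsetHamiltonianCycle : ∀ {n} → Graph n → Subset n → Cycle n → Set
IsSubsetHamiltonianCycle G V C = cycleGraph C ⊆ᴳ G × (∀ x → x ∈ V → x List.∈ nodes C)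

DifferInAnEdge : ∀ {n} → Cycle n → Cycle n → Set
DifferInAnEdge C D = ∃[ x ] ∃[ y ]
  (  (Adj (cycleGraph C) x y × ¬ Adj (cycleGraph D) x y)
  ⊎ (¬ Adj (cycleGraph C) x y × Adj (cycleGraph D) x y))

HasSecondHamiltonianCycle : ∀ {n} → Graph n → Subset n → Set
HasSecondHamiltonianCycle {n} G V =
  Σ[ C ∈ Cycle n ] Σ[ D ∈ Cycle n ]
    IsHamiltonianCycleOn G V C × IsSubsetHamiltonianCycle G V D × DifferInAnEdge C D

module Submission where

open import Data.Bool as Bool using (Bool; true; false; not; _∧_; _∨_; _xor_; if_then_else_)
open import Data.Bool.Properties using (xor-same; xor-comm; xor-assoc; xor-identityʳ; ∧-zeroʳ; ∧-identityʳ; ∧-comm; ∧-distribˡ-xor; not-involutive; ¬-not)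
open import Data.Bool.Solver using (module xor-∧-Solver)
open import Data.Fin using (Fin; zero; suc)
open import Data.Fin.Properties using (_≟_; any?; all?; injective⇒≤)
open import Data.Fin.Subset using (Subset; _∩_; ∣_∣) renaming (_∈_ to _∈ˢ_)
open import Data.Fin.Subset.Properties using (x∈p∩q⁺; ∉⊥)
open import Data.List as List using (List; []; _∷_; _++_; _∷ʳ_; _ʳ++_; map; filter; zip; reverse; last; length; break; allFin; cartesianProduct; cartesianProductWith)
open import Data.List.Membership.Propositional using (_∈_; _∉_; find; lose)
import Data.List.Membership.DecPropositional as DecMembership
open import Data.List.Membership.Propositional.Properties using (∈-allFin; ∈-lookup; ∈-++⁺ʳ; ∈-++⁻; ∈-∃++; ∈-filter⁺; ∈-filter⁻; ∈-cartesianProduct⁺; ∈-cartesianProduct⁻; ∈-cartesianProductWith⁺; ∈-cartesianProductWith⁻)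
open import Data.List.Properties using (≡-dec; ∷-injective; ∷-injectiveˡ; ++-cancelʳ; length-++; length-reverse; unfold-reverse; reverse-involutive; ʳ++-defn)
open import Data.List.Relation.Binary.Permutation.Propositional using (_↭_; prep; ↭-sym; ↭⇒↭ₛ)
open import Data.List.Relation.Binary.Permutation.Propositional.Properties using (∈-resp-↭; ↭-reverse; ++⁺ʳ; ∷↭∷ʳ)
import Data.List.Relation.Binary.Permutation.Setoid.Properties as Permutation
open import Data.List.Relation.Unary.All as All using (All; []; _∷_)
import Data.List.Relation.Unary.All.Properties as All
open import Data.List.Relation.Unary.AllPairs using ([]; _∷_)
open import Data.List.Relation.Unary.Any as Any using (here; there)
open import Data.List.Relation.Unary.Linked as Linked using (Linked; []; [-]; _∷_; linked?)
open import Data.List.Relation.Unary.Unique.DecPropositional using (unique?)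
open import Data.List.Relation.Unary.Unique.Propositional using (Unique)
open import Data.List.Relation.Unary.Unique.Propositional.Properties using (allFin⁺; cartesianProduct⁺; cartesianProductWith⁺; filter⁺; Unique[x∷xs]⇒x∉xs)
open import Data.Maybe using (just)
import Data.Maybe.Properties as Maybe
open import Data.Nat using (ℕ; zero; suc; _*_; _≤_; _<_; z≤n; s≤s)
open import Data.Nat.Divisibility using (_∣_; divides)
open import Data.Nat.Properties using (+-comm; suc-injective)
open import Data.Product using (_×_; _,_; ∃-syntax; proj₁; proj₂)
open import Data.Product.Properties using () renaming (≡-dec to ×-≡-dec)
open import Data.Sum as Sum using (_⊎_; inj₁; inj₂; [_,_])
open import Data.Vec using ([]; _∷_; lookup; tabulate)
open import Data.Vec.Properties using ([]=⇒lookup; lookup⇒[]=; lookup-zipWith; lookup∘tabulate)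
open import Defs
open import Function using (_∘_; id)
open import Function.Bundles using (_⇔_; mk⇔; Equivalence)
open import Relation.Binary.Construct.Closure.ReflexiveTransitive as Star using (Star; ε; _◅_; _◅◅_)
open import Relation.Binary.Definitions using (DecidableEquality)
open import Relation.Binary.PropositionalEquality using (_≡_; _≢_; refl; sym; trans; cong; cong₂; subst; setoid; module ≡-Reasoning)
open import Relation.Nullary using (Dec; yes; no; does; ¬_; contradiction)
open import Relation.Nullary.Decidable using (dec-true; dec-false; _×-dec_; _→-dec_; ¬?; decidable-stable)
open import Relation.Unary using (Decidable)

-- Some J ⊆ E has odd degree exactly at the nodes of V: sum, modulo 2, walks from
-- the nodes of V to a root of their component.  Together with H this gives a graph
-- with odd degree on V and even degree elsewhere, to which Thomason's lollipop
-- argument extends.  Fix the step t → s of H and let p range over the paths to t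
-- avoiding s such that s ∷ p visits V.  A pair of such a p and a neighbour y ≠ s of
-- its head x is mapped by an involution: p is extended by y if y is not on p,
-- shortened by x if y follows x and x ∉ V, and otherwise reversed up to y.  Its fixed
-- points are the pairs in which x ∈ V and y follows x, one for each p with head in V.
-- Counting pairs by degrees, the number of p whose head is adjacent to s is even, so
-- the path of H is not the only one; and two cycles through t → s have the same edges
-- only if they agree.

private variable
  A B : Set

_∈?_ : ∀ {n} (x : Fin n) xs → Dec (x ∈ xs)
_∈?_ = DecMembership._∈?_ _≟_

_∈²?_ : ∀ {n} (e : Fin n × Fin n) es → Dec (e ∈ es)
_∈²?_ = DecMembership._∈?_ (×-≡-dec _≟_ _≟_)

does-cong : ∀ {P Q : Set} (P? : Dec P) (Q? : Dec Q) → (P → Q) → (Q → P) → does P? ≡ does Q?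
does-cong (yes p) Q? f g = sym (dec-true Q? (f p))
does-cong (no ¬p) Q? f g = sym (dec-false Q? (¬p ∘ g))

-- Sums modulo 2

⨁ : List A → (A → Bool) → Bool
⨁ []       f = false
⨁ (x ∷ xs) f = f x xor ⨁ xs f

⨁-cong : ∀ (xs : List A) {f g : A → Bool} → (∀ {x} → x ∈ xs → f x ≡ g x) → ⨁ xs f ≡ ⨁ xs g
⨁-cong []       f≗g = refl
⨁-cong (x ∷ xs) f≗g = cong₂ _xor_ (f≗g (here refl)) (⨁-cong xs (f≗g ∘ there))

⨁-false : ∀ (xs : List A) → ⨁ xs (λ _ → false) ≡ false
⨁-false []       = refl
⨁-false (x ∷ xs) = ⨁-false xs

⨁-xor : ∀ (xs : List A) (f g : A → Bool) → ⨁ xs (λ x → f x xor g x) ≡ ⨁ xs f xor ⨁ xs g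
⨁-xor []       f g = refl
⨁-xor (x ∷ xs) f g rewrite ⨁-xor xs f g =
  solve 4 (λ a b c d → (a :+ b) :+ (c :+ d) := (a :+ c) :+ (b :+ d)) refl (f x) (g x) (⨁ xs f) (⨁ xs g)
  where open xor-∧-Solver

⨁-∧ : ∀ b (xs : List A) (f : A → Bool) → ⨁ xs (λ x → b ∧ f x) ≡ b ∧ ⨁ xs f
⨁-∧ true  xs f = refl
⨁-∧ false xs f = ⨁-false xs

⨁-comm : ∀ (xs : List A) (ys : List B) (f : A → B → Bool) →
         ⨁ xs (λ x → ⨁ ys (f x)) ≡ ⨁ ys (λ y → ⨁ xs (λ x → f x y))
⨁-comm []       ys f = sym (⨁-false ys)
⨁-comm (x ∷ xs) ys f =
  trans (cong (⨁ ys (f x) xor_) (⨁-comm xs ys f)) (sym (⨁-xor ys (f x) (λ y → ⨁ xs (λ z → f z y))))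

⨁-++ : ∀ (xs ys : List A) f → ⨁ (xs ++ ys) f ≡ ⨁ xs f xor ⨁ ys f
⨁-++ []       ys f = refl
⨁-++ (x ∷ xs) ys f = trans (cong (f x xor_) (⨁-++ xs ys f)) (sym (xor-assoc (f x) _ _))

⨁-map : ∀ (g : A → B) xs f → ⨁ (map g xs) f ≡ ⨁ xs (f ∘ g)
⨁-map g []       f = refl
⨁-map g (x ∷ xs) f = cong (f (g x) xor_) (⨁-map g xs f)

⨁-cartesianProduct : ∀ (xs : List A) (ys : List B) f →
  ⨁ (cartesianProduct xs ys) f ≡ ⨁ xs (λ x → ⨁ ys (λ y → f (x , y)))
⨁-cartesianProduct []       ys f = refl
⨁-cartesianProduct (x ∷ xs) ys f =
  trans (⨁-++ (map (x ,_) ys) _ f) (cong₂ _xor_ (⨁-map (x ,_) ys f) (⨁-cartesianProduct xs ys f))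

⨁-filter : ∀ {P : A → Set} (P? : Decidable P) xs f →
           ⨁ (filter P? xs) f ≡ ⨁ xs (λ x → does (P? x) ∧ f x)
⨁-filter P? []       f = refl
⨁-filter P? (x ∷ xs) f with does (P? x)
... | true  = cong (f x xor_) (⨁-filter P? xs f)
... | false = ⨁-filter P? xs f

⨁-zero : ∀ (xs : List A) {f : A → Bool} → (∀ {x} → x ∈ xs → f x ≡ false) → ⨁ xs f ≡ false
⨁-zero xs f≡0 = trans (⨁-cong xs f≡0) (⨁-false xs)

⨁-single : ∀ {xs : List A} {f z} → Unique xs → z ∈ xs → (∀ {x} → x ∈ xs → x ≢ z → f x ≡ false) → ⨁ xs f ≡ f z
⨁-single {xs = _ ∷ xs} {f} (z∉ ∷ _) (here refl) f≡0 =
  trans (cong (f _ xor_) (⨁-zero xs λ x∈ → f≡0 (there x∈) λ { refl → All.lookup z∉ x∈ refl }))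
        (xor-identityʳ (f _))
⨁-single {xs = x ∷ _} {f} (x∉ ∷ u) (there z∈) f≡0
  rewrite f≡0 (here refl) (All.lookup x∉ z∈) = ⨁-single u z∈ (f≡0 ∘ there)

-- Modulo 2 the off-diagonal entries `M x y` and `M y x` cancel in pairs; the induction splits off
-- the first row and the first column.
⨁-symmetric : ∀ (xs : List A) (M : A → A → Bool) → (∀ {x y} → x ∈ xs → y ∈ xs → M x y ≡ M y x) →
              ⨁ xs (λ x → ⨁ xs (M x)) ≡ ⨁ xs (λ x → M x x)
⨁-symmetric []       M M-sym = refl
⨁-symmetric (x ∷ xs) M M-sym = begin
  (M x x xor ⨁ xs (M x)) xor ⨁ xs (λ y → M y x xor ⨁ xs (M y))
    ≡⟨ cong ((M x x xor ⨁ xs (M x)) xor_) (⨁-xor xs (λ y → M y x) (λ y → ⨁ xs (M y))) ⟩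
  (M x x xor ⨁ xs (M x)) xor (⨁ xs (λ y → M y x) xor ⨁ xs (λ y → ⨁ xs (M y)))
    ≡⟨ cong₂ (λ a b → (M x x xor ⨁ xs (M x)) xor (a xor b))
         (⨁-cong xs λ y∈ → M-sym (there y∈) (here refl))
         (⨁-symmetric xs M λ y∈ z∈ → M-sym (there y∈) (there z∈)) ⟩
  (M x x xor ⨁ xs (M x)) xor (⨁ xs (M x) xor ⨁ xs (λ y → M y y))
    ≡⟨ xor-assoc (M x x) (⨁ xs (M x)) _ ⟩
  M x x xor (⨁ xs (M x) xor (⨁ xs (M x) xor ⨁ xs (λ y → M y y)))
    ≡⟨ cong (M x x xor_) (sym (xor-assoc (⨁ xs (M x)) _ _)) ⟩
  M x x xor ((⨁ xs (M x) xor ⨁ xs (M x)) xor ⨁ xs (λ y → M y y))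
    ≡⟨ cong (λ a → M x x xor (a xor _)) (xor-same (⨁ xs (M x))) ⟩
  M x x xor ⨁ xs (λ y → M y y) ∎
  where open ≡-Reasoning

-- View `τ` as a permutation matrix on `xs`. Each row has a single true entry and the matrix is
-- symmetric because `τ` is its own inverse, so by `⨁-symmetric` only the diagonal, that is the
-- fixed points, counts.
⨁-involution : ∀ (_≟ᴬ_ : DecidableEquality A) {xs} (τ : A → A) → Unique xs →
  (∀ {x} → x ∈ xs → τ x ∈ xs × τ (τ x) ≡ x) →
  ⨁ xs (λ _ → true) ≡ ⨁ xs (λ x → does (τ x ≟ᴬ x))
⨁-involution _≟ᴬ_ {xs} τ u inv = begin
  ⨁ xs (λ _ → true)
    ≡⟨ ⨁-cong xs (λ {x} x∈ → sym (trans
         (⨁-single u (proj₁ (inv x∈)) (λ {y} _ y≢ → dec-false (τ x ≟ᴬ y) (y≢ ∘ sym)))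
         (dec-true (τ x ≟ᴬ τ x) refl))) ⟩
  ⨁ xs (λ x → ⨁ xs (λ y → does (τ x ≟ᴬ y)))
    ≡⟨ ⨁-symmetric xs _ τ-sym ⟩
  ⨁ xs (λ x → does (τ x ≟ᴬ x)) ∎
  where
  open ≡-Reasoning
  τ-sym : ∀ {x y} → x ∈ xs → y ∈ xs → does (τ x ≟ᴬ y) ≡ does (τ y ≟ᴬ x)
  τ-sym {x} {y} x∈ y∈ = does-cong (τ x ≟ᴬ y) (τ y ≟ᴬ x)
    (λ { refl → proj₂ (inv x∈) }) (λ { refl → proj₂ (inv y∈) })

∑ : ∀ {n} → (Fin n → Bool) → Bool
∑ = ⨁ (allFin _)

∑-single : ∀ {n} {f : Fin n → Bool} z → (∀ {x} → x ≢ z → f x ≡ false) → ∑ f ≡ f z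
∑-single z f≡0 = ⨁-single (allFin⁺ _) (∈-allFin z) (λ _ → f≡0)

∑-δ : ∀ {n} (f : Fin n → Bool) z → ∑ (λ x → does (x ≟ z) ∧ f x) ≡ f z
∑-δ f z = trans (∑-single z (λ {x} x≢z → cong (_∧ f x) (dec-false (x ≟ z) x≢z)))
                (cong (_∧ f z) (dec-true (z ≟ z) refl))

∑-cong : ∀ {n} {f g : Fin n → Bool} → (∀ x → f x ≡ g x) → ∑ f ≡ ∑ g
∑-cong f≗g = ⨁-cong (allFin _) (λ {x} _ → f≗g x)

-- T-joins

odd : ℕ → Bool
odd zero    = false
odd (suc k) = not (odd k)

2∣⇒odd≡false : ∀ {k} → 2 ∣ k → odd k ≡ false
2∣⇒odd≡false (divides q refl) = even q
  where
  even : ∀ q → odd (q * 2) ≡ false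
  even zero    = refl
  even (suc q) = trans (not-involutive _) (even q)

-- `allFin` is a tabulation whose tail is shifted by `suc`, so the induction needs an arbitrary `g`
-- in place of `id`.
⨁-tabulate-lookup : ∀ {n} {A : Set} {f : A → Bool} (g : Fin n → A) (S : Subset n) →
  (∀ i → f (g i) ≡ lookup S i) → ⨁ (List.tabulate g) f ≡ odd ∣ S ∣
⨁-tabulate-lookup g []          fg≗S = refl
⨁-tabulate-lookup g (true ∷ S)  fg≗S =
  cong₂ _xor_ (fg≗S zero) (⨁-tabulate-lookup (g ∘ suc) S (fg≗S ∘ suc))
⨁-tabulate-lookup g (false ∷ S) fg≗S =
  cong₂ _xor_ (fg≗S zero) (⨁-tabulate-lookup (g ∘ suc) S (fg≗S ∘ suc))

∑-lookup : ∀ {n} (S : Subset n) → ∑ (lookup S) ≡ odd ∣ S ∣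
∑-lookup S = ⨁-tabulate-lookup id S (λ _ → refl)

module _ {n} (G : Graph n) where

  -- Union–find.
  mergeAll : List (Fin n × Fin n) → Fin n → Fin n
  mergeAll []             x = x
  mergeAll ((a , b) ∷ es) x =
    let r = mergeAll es in
    -- The class of `a` is redirected to the representative of `b`. Testing `adj? G a b` allows the
    -- list to hold all pairs of nodes.
    if does (adj? G a b) ∧ does (r x ≟ r a) then r b else r x

  root : Fin n → Fin n
  root = mergeAll (cartesianProduct (allFin n) (allFin n))

  mergeAll-walk : ∀ es x → Star (Adj G) x (mergeAll es x)
  mergeAll-walk []             x = ε
  mergeAll-walk ((a , b) ∷ es) x with adj? G a b | mergeAll es x ≟ mergeAll es a
  ... | yes ab | yes rx≡ra = mergeAll-walk es x ◅◅
          subst (λ y → Star (Adj G) y a) (sym rx≡ra) (Star.reverse (adj-sym G) (mergeAll-walk es a)) ◅◅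
          ab ◅ mergeAll-walk es b
  ... | yes _  | no _      = mergeAll-walk es x
  ... | no _   | _         = mergeAll-walk es x

  -- Once merged along their edge, the two ends share a representative; any further merge depends on
  -- the representative alone and keeps them together.
  mergeAll-adj : ∀ {es a b} → (a , b) ∈ es → Adj G a b → mergeAll es a ≡ mergeAll es b
  mergeAll-adj {(a , b) ∷ es} (here refl) ab
    rewrite dec-true (adj? G a b) ab | dec-true (mergeAll es a ≟ mergeAll es a) refl
    with does (mergeAll es b ≟ mergeAll es a)
  ... | true  = refl
  ... | false = refl
  mergeAll-adj {(c , d) ∷ es} (there e) ab =
    cong (λ z → if does (adj? G c d) ∧ does (z ≟ mergeAll es c) then mergeAll es d else z) (mergeAll-adj e ab)

  root-walk : ∀ x → Star (Adj G) x (root x)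
  root-walk = mergeAll-walk (cartesianProduct (allFin n) (allFin n))

  walk⇒root≡ : ∀ {x y} → Star (Adj G) x y → root x ≡ root y
  walk⇒root≡ ε        = refl
  walk⇒root≡ (e ◅ es) = trans (mergeAll-adj (∈-cartesianProduct⁺ (∈-allFin _) (∈-allFin _)) e) (walk⇒root≡ es)

  root≡⇒walk : ∀ {x y} → root x ≡ root y → Star (Adj G) x y
  root≡⇒walk {x} {y} eq = subst (Star (Adj G) x) eq (root-walk x) ◅◅ Star.reverse (adj-sym G) (root-walk y)

-- Edges and walks as adjacency matrices modulo 2

link : ∀ {n} → Fin n → Fin n → Fin n → Fin n → Bool
link x y u v = (does (u ≟ x) ∧ does (v ≟ y)) xor (does (u ≟ y) ∧ does (v ≟ x))

link-sym : ∀ {n} (x y u v : Fin n) → link x y u v ≡ link x y v u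
link-sym x y u v = trans (xor-comm (does (u ≟ x) ∧ does (v ≟ y)) _)
  (cong₂ _xor_ (∧-comm (does (u ≟ y)) _) (∧-comm (does (u ≟ x)) _))

link-true : ∀ {n} (x y u v : Fin n) → link x y u v ≡ true → (u ≡ x × v ≡ y) ⊎ (u ≡ y × v ≡ x)
link-true x y u v eq with u ≟ x | v ≟ y | u ≟ y | v ≟ x
... | yes u≡x | yes v≡y | _       | _       = inj₁ (u≡x , v≡y)
... | _       | _       | yes u≡y | yes v≡x = inj₂ (u≡y , v≡x)
... | no _    | _       | no _    | _       with () ← eq
... | no _    | _       | yes _   | no _    with () ← eq
... | yes _   | no _    | no _    | _       with () ← eq
... | yes _   | no _    | yes _   | no _    with () ← eq

∑-≟ : ∀ {n} (z : Fin n) → ∑ (λ x → does (x ≟ z)) ≡ true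
∑-≟ z = trans (∑-single z (λ {x} x≢z → dec-false (x ≟ z) x≢z)) (dec-true (z ≟ z) refl)

-- Since `link` uses `xor`, it vanishes when `x ≡ y`, which lets the formula hold without assuming
-- distinct ends.
link-degree : ∀ {n} (x y u : Fin n) → ∑ (link x y u) ≡ does (u ≟ x) xor does (u ≟ y)
link-degree x y u = trans (⨁-xor (allFin _) (λ v → does (u ≟ x) ∧ does (v ≟ y)) _)
  (cong₂ _xor_ (half x y) (half y x))
  where
  half : ∀ a b → ∑ (λ v → does (u ≟ a) ∧ does (v ≟ b)) ≡ does (u ≟ a)
  half a b = trans (⨁-∧ (does (u ≟ a)) (allFin _) (λ v → does (v ≟ b)))
    (trans (cong (does (u ≟ a) ∧_) (∑-≟ b)) (∧-identityʳ _))

module _ {n} {G : Graph n} where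

  -- The edges traversed an odd number of times.
  trace : ∀ {x y} → Star (Adj G) x y → Fin n → Fin n → Bool
  trace ε                            u v = false
  trace (_◅_ {i = x} {j = y} _ walk) u v = link x y u v xor trace walk u v

  trace-sym : ∀ {x y} (w : Star (Adj G) x y) u v → trace w u v ≡ trace w v u
  trace-sym ε       u v = refl
  trace-sym (_ ◅ w) u v = cong₂ _xor_ (link-sym _ _ u v) (trace-sym w u v)

  trace-true : ∀ {x y} (w : Star (Adj G) x y) {u v} → trace w u v ≡ true → Adj G u v
  trace-true (_◅_ {i = x} {j = y} e w) {u} {v} eq with link x y u v in l
  ... | false = trace-true w eq
  ... | true with link-true x y u v l
  ...   | inj₁ (refl , refl) = e
  ...   | inj₂ (refl , refl) = adj-sym G e

  -- The degrees of the single links telescope: each inner visit of the walk is counted twice, and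
  -- only the two ends remain.
  trace-degree : ∀ {x y} (w : Star (Adj G) x y) u → ∑ (trace w u) ≡ does (u ≟ x) xor does (u ≟ y)
  trace-degree {x} ε                           u = trans (⨁-false (allFin n)) (sym (xor-same (does (u ≟ x))))
  trace-degree {x} {z} (_◅_ {j = y} e w) u = begin
    ∑ (λ v → link x y u v xor trace w u v)
      ≡⟨ ⨁-xor (allFin n) (link x y u) (trace w u) ⟩
    ∑ (link x y u) xor ∑ (trace w u)
      ≡⟨ cong₂ _xor_ (link-degree x y u) (trace-degree w u) ⟩
    (does (u ≟ x) xor does (u ≟ y)) xor (does (u ≟ y) xor does (u ≟ z))
      ≡⟨ xor-assoc (does (u ≟ x)) _ _ ⟩
    does (u ≟ x) xor (does (u ≟ y) xor (does (u ≟ y) xor does (u ≟ z)))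
      ≡⟨ cong (does (u ≟ x) xor_) (sym (xor-assoc (does (u ≟ y)) _ _)) ⟩
    does (u ≟ x) xor ((does (u ≟ y) xor does (u ≟ y)) xor does (u ≟ z))
      ≡⟨ cong (λ b → does (u ≟ x) xor (b xor does (u ≟ z))) (xor-same (does (u ≟ y))) ⟩
    does (u ≟ x) xor does (u ≟ z) ∎
    where open ≡-Reasoning

⨁-true⇒∃ : ∀ {A : Set} (xs : List A) f → ⨁ xs f ≡ true → ∃[ x ] f x ≡ true
⨁-true⇒∃ (x ∷ xs) f eq with f x in fx
... | true  = x , fx
... | false = ⨁-true⇒∃ xs f eq

-- A T-join of `G` for the node set `V`, given by its adjacency matrix so that degrees are sums
-- modulo 2.
record Join {n} (V : Subset n) (G : Graph n) : Set where
  field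
    J      : Fin n → Fin n → Bool
    J-sym  : ∀ u v → J u v ≡ J v u
    J⊆     : ∀ {u v} → J u v ≡ true → Adj G u v
    degree : ∀ u → ∑ (J u) ≡ lookup V u

-- In the sum of the walks from nodes of `V` to their roots, `u` is an end once if it lies in `V`,
-- and once more for every node of `V` with root `u`. The latter number is even: these nodes, if
-- there are any, are those of `V` in one component.
join : ∀ {n} (V : Subset n) (G : Graph n) →
       (∀ T → IsComponent G T → EvenlyMany (V ∩ T)) → Join V G
join {n} V G even = record { J = J ; J-sym = J-sym ; J⊆ = J⊆ ; degree = degree }
  where
  walk : ∀ x → Fin n → Fin n → Bool
  walk x = trace {G = G} (root-walk G x)

  J : Fin n → Fin n → Bool
  J u v = ∑ (λ x → lookup V x ∧ walk x u v)

  J-sym : ∀ u v → J u v ≡ J v u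
  J-sym u v = ∑-cong (λ x → cong (lookup V x ∧_) (trace-sym (root-walk G x) u v))

  J⊆ : ∀ {u v} → J u v ≡ true → Adj G u v
  J⊆ {u} {v} eq with x , fx ← ⨁-true⇒∃ (allFin n) _ eq with lookup V x
  ... | true = trace-true (root-walk G x) fx
  ... | false with () ← fx

  rootedAt : Fin n → Subset n
  rootedAt u = tabulate (λ x → does (root G x ≟ u))

  rootedAt⇒ : ∀ {u x} → x ∈ˢ rootedAt u → root G x ≡ u
  rootedAt⇒ {u} {x} x∈ with root G x ≟ u | trans (sym (lookup∘tabulate _ x)) ([]=⇒lookup x∈)
  ... | yes eq | _ = eq

  ⇒rootedAt : ∀ {u x} → root G x ≡ u → x ∈ˢ rootedAt u
  ⇒rootedAt {u} {x} eq = lookup⇒[]= x _ (trans (lookup∘tabulate _ x) (dec-true (root G x ≟ u) eq))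

  rootedAt-component : ∀ {u x} → root G x ≡ u → IsComponent G (rootedAt u)
  rootedAt-component {u} {x} eq = (x , ⇒rootedAt eq) , λ y∈ z → mk⇔
    (λ z∈ → root≡⇒walk G (trans (rootedAt⇒ y∈) (sym (rootedAt⇒ z∈))))
    (λ w  → ⇒rootedAt (trans (sym (walk⇒root≡ G w)) (rootedAt⇒ y∈)))

  even-at-root : ∀ u → ∑ (λ x → lookup V x ∧ does (u ≟ root G x)) ≡ false
  even-at-root u with any? (λ x → root G x ≟ u)
  ... | no ∄ = ⨁-zero (allFin n) λ {x} _ →
          trans (cong (lookup V x ∧_) (dec-false (u ≟ root G x) (λ eq → ∄ (x , sym eq)))) (∧-zeroʳ (lookup V x))
  ... | yes (_ , eq) = trans (∑-cong pointwise)
          (trans (∑-lookup (V ∩ rootedAt u)) (2∣⇒odd≡false (even _ (rootedAt-component eq))))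
    where
    pointwise : ∀ x → lookup V x ∧ does (u ≟ root G x) ≡ lookup (V ∩ rootedAt u) x
    pointwise x = trans (cong (lookup V x ∧_) (trans (does-cong (u ≟ root G x) (root G x ≟ u) sym sym) (sym (lookup∘tabulate _ x))))
                        (sym (lookup-zipWith _∧_ x V (rootedAt u)))

  degree : ∀ u → ∑ (J u) ≡ lookup V u
  degree u = begin
    ∑ (λ v → ∑ (λ x → lookup V x ∧ walk x u v))
      ≡⟨ ⨁-comm (allFin n) (allFin n) (λ v x → lookup V x ∧ walk x u v) ⟩
    ∑ (λ x → ∑ (λ v → lookup V x ∧ walk x u v))
      ≡⟨ ∑-cong (λ x → trans (⨁-∧ (lookup V x) (allFin n) _)
           (trans (cong (lookup V x ∧_) (trace-degree (root-walk G x) u))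
                  (∧-distribˡ-xor (lookup V x) (does (u ≟ x)) (does (u ≟ root G x))))) ⟩
    ∑ (λ x → (lookup V x ∧ does (u ≟ x)) xor (lookup V x ∧ does (u ≟ root G x)))
      ≡⟨ ⨁-xor (allFin n) (λ x → lookup V x ∧ does (u ≟ x)) _ ⟩
    ∑ (λ x → lookup V x ∧ does (u ≟ x)) xor ∑ (λ x → lookup V x ∧ does (u ≟ root G x))
      ≡⟨ cong₂ _xor_ picks-u (even-at-root u) ⟩
    lookup V u xor false
      ≡⟨ xor-identityʳ _ ⟩
    lookup V u ∎
    where
    open ≡-Reasoning
    picks-u : ∑ (λ x → lookup V x ∧ does (u ≟ x)) ≡ lookup V u
    picks-u = trans
      (∑-single u λ {x} x≢u → trans (cong (lookup V x ∧_) (dec-false (u ≟ x) (x≢u ∘ sym))) (∧-zeroʳ _))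
      (trans (cong (lookup V u ∧_) (dec-true (u ≟ u) refl)) (∧-identityʳ _))

-- The lollipop argument

lookup-injective : ∀ {xs : List A} → Unique xs → ∀ {i j} → List.lookup xs i ≡ List.lookup xs j → i ≡ j
lookup-injective (x∉ ∷ u) {zero}  {zero}  eq = refl
lookup-injective (x∉ ∷ u) {zero}  {suc j} eq = contradiction eq (All.lookup x∉ (∈-lookup j))
lookup-injective (x∉ ∷ u) {suc i} {zero}  eq = contradiction (sym eq) (All.lookup x∉ (∈-lookup i))
lookup-injective (x∉ ∷ u) {suc i} {suc j} eq = cong suc (lookup-injective u eq)

Unique⇒length≤ : ∀ {n} {xs : List (Fin n)} → Unique xs → length xs ≤ n
Unique⇒length≤ u = injective⇒≤ (lookup-injective u)

-- A finite range for sums over paths: a path repeats no node, so by `Unique⇒length≤` it occurs in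
-- `listsUpTo n n`.
listsUpTo : ∀ n → ℕ → List (List (Fin n))
listsUpTo n zero    = [] ∷ []
listsUpTo n (suc k) = [] ∷ cartesianProductWith _∷_ (allFin n) (listsUpTo n k)

listsUpTo-unique : ∀ n k → Unique (listsUpTo n k)
listsUpTo-unique n zero    = [] ∷ []
listsUpTo-unique n (suc k) =
  All.tabulate []≢ ∷ cartesianProductWith⁺ _∷_ ∷-injective (allFin⁺ n) (listsUpTo-unique n k)
  where
  []≢ : ∀ {xs} → xs ∈ cartesianProductWith _∷_ (allFin n) (listsUpTo n k) → [] ≢ xs
  []≢ xs∈ refl with () ← proj₂ (proj₂ (proj₂ (proj₂ (∈-cartesianProductWith⁻ _∷_ (allFin n) (listsUpTo n k) xs∈))))

∈-listsUpTo : ∀ {n k} {xs : List (Fin n)} → length xs ≤ k → xs ∈ listsUpTo n k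
∈-listsUpTo {k = zero}  {[]}     z≤n       = here refl
∈-listsUpTo {k = suc k} {[]}     z≤n       = here refl
∈-listsUpTo {k = suc k} {x ∷ xs} (s≤s len) = there (∈-cartesianProductWith⁺ _∷_ (∈-allFin x) (∈-listsUpTo len))

last-++-∷ : ∀ (xs : List A) {y ys} → last (xs ++ y ∷ ys) ≡ last (y ∷ ys)
last-++-∷ []            = refl
last-++-∷ (x ∷ [])      = refl
last-++-∷ (x ∷ x′ ∷ xs) = last-++-∷ (x′ ∷ xs)

module _ {R : A → A → Set} where

  Linked-++⁻ˡ : ∀ xs {ys} → Linked R (xs ++ ys) → Linked R xs
  Linked-++⁻ˡ []            l       = []
  Linked-++⁻ˡ (x ∷ [])      l       = [-]
  Linked-++⁻ˡ (x ∷ x′ ∷ xs) (r ∷ l) = r ∷ Linked-++⁻ˡ (x′ ∷ xs) l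

  Linked-++⁻ʳ : ∀ xs {ys} → Linked R (xs ++ ys) → Linked R ys
  Linked-++⁻ʳ []       l = l
  Linked-++⁻ʳ (x ∷ xs) l = Linked-++⁻ʳ xs (Linked.tail l)

  -- Two walks leaving `x` are glued at `x`, the first one run backwards.
  Linked-ʳ++ : (∀ {x y} → R x y → R y x) → ∀ {x xs ys} →
               Linked R (x ∷ xs) → Linked R (x ∷ ys) → Linked R ((x ∷ xs) ʳ++ ys)
  Linked-ʳ++ R-sym {xs = []}    l       l′ = l′
  Linked-ʳ++ R-sym {xs = _ ∷ _} (r ∷ l) l′ = Linked-ʳ++ R-sym l (R-sym r ∷ l′)

Unique-resp-↭ : ∀ {xs ys : List A} → xs ↭ ys → Unique xs → Unique ys
Unique-resp-↭ p = Permutation.Unique-resp-↭ (setoid _) (↭⇒↭ₛ p)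

Unique-++-∷⇒∉ : ∀ (xs : List A) {y ys} → Unique (xs ++ y ∷ ys) → y ∉ xs
Unique-++-∷⇒∉ (x ∷ xs) (x∉ ∷ u) (here refl) = All.lookup x∉ (∈-++⁺ʳ xs (here refl)) refl
Unique-++-∷⇒∉ (x ∷ xs) (_ ∷ u)  (there y∈)  = Unique-++-∷⇒∉ xs u y∈

Unique-++⁻ˡ : ∀ (xs : List A) {ys} → Unique (xs ++ ys) → Unique xs
Unique-++⁻ˡ []       u        = []
Unique-++⁻ˡ (x ∷ xs) (x∉ ∷ u) = All.++⁻ˡ xs x∉ ∷ Unique-++⁻ˡ xs u

-- The head of the reversed list comes from `x′ ∷ xs`, where `x` does not occur.
reverse≢self : ∀ {x x′ : A} {xs} → Unique (x ∷ x′ ∷ xs) → reverse (x ∷ x′ ∷ xs) ≢ x ∷ x′ ∷ xs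
reverse≢self {x = x} {x′} {xs} (x∉ ∷ _) eq
  with reverse (x′ ∷ xs) in r | trans (sym (unfold-reverse x (x′ ∷ xs))) eq
... | []     | ()
... | z ∷ zs | eq′ = contradiction refl (All.lookup x∉
        (∈-resp-↭ (↭-reverse (x′ ∷ xs)) (subst (x ∈_) (sym r) (here (sym (∷-injectiveˡ eq′))))))

-- The matrix `a` describes a graph whose degree is odd exactly at the nodes of `V`. The nodes `u`
-- and `w` ensure that every valid path has a second node.
module Lollipop {n} (V : Fin n → Bool) (a : Fin n → Fin n → Bool)
  (a-sym : ∀ x y → a x y ≡ a y x) (a-irrefl : ∀ x → a x x ≡ false)
  (a-degree : ∀ x → ∑ (a x) ≡ V x)
  (s t : Fin n)
  (u w : Fin n) (u≢w : u ≢ w) (u∈ : V u ≡ true × u ≢ s) (w∈ : V w ≡ true × w ≢ s)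
  where

  Adjacent : Fin n → Fin n → Set
  Adjacent x y = a x y ≡ true

  -- The path is listed from its free end to its fixed end `t`. When its head is adjacent to `s`, it
  -- closes up with the step from `t` to `s` to a cycle that visits all of `V`.
  Valid : List (Fin n) → Set
  Valid p = Unique (s ∷ p) × Linked Adjacent p × last p ≡ just t × (∀ v → V v ≡ true × v ≢ s → v ∈ p)

  valid? : ∀ p → Dec (Valid p)
  valid? p = unique? _≟_ (s ∷ p) ×-dec linked? (λ x y → a x y Bool.≟ true) p
    ×-dec Maybe.≡-dec _≟_ (last p) (just t)
    ×-dec all? (λ v → ((V v Bool.≟ true) ×-dec ¬? (v ≟ s)) →-dec (v ∈? p))

  atLeastTwo : ∀ {p} → Valid p → ∃[ x ] ∃[ y ] ∃[ q ] p ≡ x ∷ y ∷ q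
  atLeastTwo {[]}        (_ , _ , _ , cover) with () ← cover u u∈
  atLeastTwo {x ∷ []}    (_ , _ , _ , cover) with cover u u∈ | cover w w∈
  ... | here refl | here refl = contradiction refl u≢w
  atLeastTwo {x ∷ y ∷ q} _ = x , y , q , refl

  -- The involution on pairs of a path and a neighbour of its head

  State : Set
  State = List (Fin n) × Fin n

  _≟ₛ_ : DecidableEquality State
  _≟ₛ_ = ×-≡-dec (≡-dec _≟_) _≟_

  leadsTo : List (Fin n) → Fin n → Bool
  leadsTo []      y = false
  leadsTo (e ∷ _) y = a e y

  -- The neighbour `s` is set aside: the edge to it closes the path into a cycle and takes no part
  -- in the moves.
  inside : List (Fin n) → Fin n → Bool
  inside p y = not (does (y ≟ s)) ∧ leadsTo p y

  headIn : List (Fin n) → Bool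
  headIn []      = false
  headIn (e ∷ _) = V e

  ValidState : State → Set
  ValidState (p , y) = Valid p × inside p y ≡ true

  -- Meant for the segment of the path in front of `y`: it is deleted if it is a single node outside
  -- `V`, since `V` then stays covered, and reversed otherwise.
  removable : List (Fin n) → Bool
  removable (e ∷ []) = not (V e)
  removable _        = false

  -- The first clause is never reached: it has y as the head of the path it should neighbour.
  turn : Fin n → List (Fin n) × List (Fin n) → State
  turn y ([]    , q)     = q , y
  turn y (e ∷ b , [])    = y ∷ e ∷ b , e
  turn y (e ∷ b , z ∷ m) = if removable (e ∷ b) then (z ∷ m , e) else (reverse (e ∷ b) ++ z ∷ m , y)

  τ : State → State
  τ (p , y) = turn y (break (_≟ y) p)

  -- On valid states this is the graph of `τ`. As a relation it is visibly symmetric, `extend` and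
  -- `shrink` being mutually inverse and `rotate` treating `b` and `c` alike, so that `τ` is an
  -- involution.
  data Move : State → State → Set where
    extend : ∀ {e q y} → y ∉ e ∷ q → V y ≡ false → Move (e ∷ q , y) (y ∷ e ∷ q , e)
    shrink : ∀ {e q y} → y ∉ e ∷ q → V y ≡ false → Move (y ∷ e ∷ q , e) (e ∷ q , y)
    rotate : ∀ {b c y m} → c ≡ reverse b → b ≡ reverse c → y ∉ b → y ∉ c →
             removable b ≡ false → removable c ≡ false → Move (b ++ y ∷ m , y) (c ++ y ∷ m , y)

  Move-sym : ∀ {S T} → Move S T → Move T S
  Move-sym (extend y∉ y∉V)            = shrink y∉ y∉V
  Move-sym (shrink y∉ y∉V)            = extend y∉ y∉V
  Move-sym (rotate cb bc yb yc rb rc) = rotate bc cb yc yb rc rb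

  break-∉ : ∀ {y} {p : List (Fin n)} → y ∉ p → break (_≟ y) p ≡ (p , [])
  break-∉ {y} {[]}    y∉ = refl
  break-∉ {y} {x ∷ p} y∉ rewrite dec-false (x ≟ y) (λ { refl → y∉ (here refl) })
                               | break-∉ {y} {p} (y∉ ∘ there) = refl

  break-++ : ∀ {y} (b : List (Fin n)) {m} → y ∉ b → break (_≟ y) (b ++ y ∷ m) ≡ (b , y ∷ m)
  break-++ {y} []          y∉ rewrite dec-true (y ≟ y) refl = refl
  break-++ {y} (x ∷ b) {m} y∉ rewrite dec-false (x ≟ y) (λ { refl → y∉ (here refl) })
                                    | break-++ {y} b {m} (y∉ ∘ there) = refl

  Move⇒τ : ∀ {S T} → Move S T → τ S ≡ T
  Move⇒τ (extend {y = y} y∉ y∉V) = cong (turn y) (break-∉ y∉)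
  -- Cutting the path at `e` leaves the single node `y` in front, which is removable because it is
  -- outside `V`.
  Move⇒τ (shrink {e} {q} {y} y∉ y∉V) =
    trans (cong (turn e) (break-++ (y ∷ []) (λ { (here refl) → y∉ (here refl) })))
          (cong (λ v → if not v then (e ∷ q , y) else (y ∷ e ∷ q , e)) y∉V)
  Move⇒τ (rotate {[]}    {y = y} refl bc yb yc rb rc) = cong (turn y) (break-++ [] yb)
  Move⇒τ (rotate {x ∷ b} {y = y} {m} refl bc yb yc rb rc) =
    trans (cong (turn y) (break-++ (x ∷ b) yb))
          (cong (λ r → if r then (y ∷ m , x) else (reverse (x ∷ b) ++ y ∷ m , y)) rb)

  inside⁻ : ∀ {p y} → inside p y ≡ true → y ≢ s × leadsTo p y ≡ true
  inside⁻ {p} {y} eq with y ≟ s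
  ... | no y≢s = y≢s , eq

  inside⁺ : ∀ {p y} → y ≢ s → leadsTo p y ≡ true → inside p y ≡ true
  inside⁺ {p} {y} y≢s eq = trans (cong (λ d → not d ∧ leadsTo p y) (dec-false (y ≟ s) y≢s)) eq

  Adjacent-sym : ∀ {x y} → Adjacent x y → Adjacent y x
  Adjacent-sym {x} {y} = trans (a-sym y x)

  removable-reverse : ∀ b → removable (reverse b) ≡ removable b
  removable-reverse []          = refl
  removable-reverse (x ∷ [])    = refl
  removable-reverse (x ∷ y ∷ b) = long-reverse (reverse (x ∷ y ∷ b)) (length-reverse (x ∷ y ∷ b))
    where
    long-reverse : ∀ c → length c ≡ suc (suc (length b)) → removable c ≡ false
    long-reverse (_ ∷ _ ∷ _) _ = refl

  -- The head after the reversal is the node that stood just before `y`, so `y` is still a neighbour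
  -- of the head.
  leadsTo-ʳ++ : ∀ x b {y m ys} → Linked Adjacent (x ∷ b ++ y ∷ m) → leadsTo ((x ∷ b) ʳ++ ys) y ≡ true
  leadsTo-ʳ++ x []       (xy ∷ _)     = xy
  leadsTo-ʳ++ x (x′ ∷ b) (_ ∷ linked) = leadsTo-ʳ++ x′ b linked

  extend-valid : ∀ {e q y} → y ∉ e ∷ q → ValidState (e ∷ q , y) → ValidState (y ∷ e ∷ q , e)
  extend-valid {e} {q} {y} y∉ ((s∉ ∷ unique , linked , lst , cover) , in≡) =
    let y≢s , ey = inside⁻ {e ∷ q} in≡
        ye = Adjacent-sym {e} {y} ey in
    (((y≢s ∘ sym) ∷ s∉) ∷ All.tabulate (λ { z∈ refl → y∉ z∈ }) ∷ unique
    , ye ∷ linked , lst , λ v v∈ → there (cover v v∈))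
    , inside⁺ {y ∷ e ∷ q} (All.head s∉ ∘ sym) ye

  shrink-valid : ∀ {e q y} → V y ≡ false → ValidState (y ∷ e ∷ q , e) → ValidState (e ∷ q , y)
  shrink-valid {e} {q} {y} y∉V (((s≢y ∷ s∉) ∷ _ ∷ unique , ye ∷ linked , lst , cover) , _) =
    (s∉ ∷ unique , linked , lst , cover′) , inside⁺ {e ∷ q} (s≢y ∘ sym) (Adjacent-sym {y} {e} ye)
    where
    cover′ : ∀ v → V v ≡ true × v ≢ s → v ∈ e ∷ q
    cover′ v v∈ with cover v v∈
    ... | there v∈q = v∈q
    ... | here refl with () ← trans (sym (proj₁ v∈)) y∉V

  -- The edge from the old head `x` to `y` replaces the edge by which the segment used to reach `y`;
  -- the node set and the end `t` stay the same.
  rotate-valid : ∀ {x b y m} → ValidState (x ∷ b ++ y ∷ m , y) → ValidState (reverse (x ∷ b) ++ y ∷ m , y)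
  rotate-valid {x} {b} {y} {m} ((unique , linked , lst , cover) , in≡) =
    let y≢s , xy = inside⁻ {x ∷ b ++ y ∷ m} in≡ in
    ( Unique-resp-↭ (prep s perm) unique
    , subst (Linked Adjacent) (ʳ++-defn (x ∷ b))
        (Linked-ʳ++ (λ {v} {z} → Adjacent-sym {v} {z}) (Linked-++⁻ˡ (x ∷ b) linked) (xy ∷ Linked-++⁻ʳ (x ∷ b) linked))
    , trans (last-++-∷ (reverse (x ∷ b))) (trans (sym (last-++-∷ (x ∷ b))) lst)
    , λ v v∈ → ∈-resp-↭ perm (cover v v∈))
    , inside⁺ {reverse (x ∷ b) ++ y ∷ m} y≢s
        (subst (λ p → leadsTo p y ≡ true) (ʳ++-defn (x ∷ b)) (leadsTo-ʳ++ x b linked))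
    where
    perm : x ∷ b ++ y ∷ m ↭ reverse (x ∷ b) ++ y ∷ m
    perm = ++⁺ʳ (y ∷ m) (↭-sym (↭-reverse (x ∷ b)))

  removable⇒ : ∀ {b} → removable b ≡ true → ∃[ x ] b ≡ x ∷ [] × V x ≡ false
  removable⇒ {x ∷ []} eq = x , refl , trans (sym (not-involutive (V x))) (cong not eq)

  step : ∀ {S} → ValidState S → ∃[ T ] Move S T × ValidState T
  step {[] , y} (_ , in≡) with () ← proj₂ (inside⁻ {[]} {y} in≡)
  step {e ∷ q , y} valid@((_ ∷ unique , _ , _ , cover) , in≡) with y ∈? (e ∷ q)
  -- The path covers `V` apart from `s`, so a neighbour off the path lies outside `V`.
  ... | no y∉ = _ , extend y∉ (¬-not λ y∈V → y∉ (cover y (y∈V , proj₁ (inside⁻ {e ∷ q} in≡)))) , extend-valid y∉ valid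
  ... | yes y∈ with ∈-∃++ y∈
  -- The head is not adjacent to itself, hence `y` is not the head.
  ...   | [] , m , refl with () ← trans (sym (a-irrefl e)) (proj₂ (inside⁻ {e ∷ m} in≡))
  ...   | _ ∷ b , m , refl with removable (e ∷ b) in r
  ...     | false = _ , rotate refl (sym (reverse-involutive (e ∷ b))) y∉b (y∉b ∘ ∈-resp-↭ (↭-reverse (e ∷ b)))
                          r (trans (removable-reverse (e ∷ b)) r) , rotate-valid valid
    where
    y∉b : y ∉ e ∷ b
    y∉b = Unique-++-∷⇒∉ (e ∷ b) unique
  ...     | true with removable⇒ {e ∷ b} r
  ...       | _ , refl , e∉V = _ , shrink (Unique[x∷xs]⇒x∉xs unique) e∉V , shrink-valid e∉V valid

  -- The moves `extend` and `shrink` change the length of the path. A rotation that changes nothing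
  -- reverses a segment without repetitions onto itself, so the segment is the head alone; not being
  -- removable, the head lies in `V`.
  fixed⇒ : ∀ {x y q z} → ValidState (x ∷ y ∷ q , z) → τ (x ∷ y ∷ q , z) ≡ (x ∷ y ∷ q , z) → z ≡ y × V x ≡ true
  fixed⇒ {x} {y} {q} {z} valid τ≡ with step valid
  ... | T , move , _ = go move refl (trans (sym (Move⇒τ move)) τ≡) valid
    where
    -- Equations between states take the place of indices because `b ++ y ∷ m` does not unify with
    -- `x ∷ y ∷ q`.
    go : ∀ {S T} → Move S T → S ≡ (x ∷ y ∷ q , z) → T ≡ (x ∷ y ∷ q , z) → ValidState S → z ≡ y × V x ≡ true
    go (extend _ _) refl ()
    go (shrink _ _) refl ()
    go (rotate {[]} {m = m} _ _ _ _ _ _) refl _ (_ , in≡)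
      with () ← trans (sym (a-irrefl x)) (proj₂ (inside⁻ {x ∷ y ∷ q} in≡))
    go (rotate {_ ∷ []} _ _ _ _ r _) refl _ _ = refl , trans (sym (not-involutive _)) (cong not r)
    go (rotate {v ∷ v′ ∷ b} {y = y′} {m} refl _ _ _ _ _) refl T≡ ((_ ∷ unique , _) , _) =
      contradiction (++-cancelʳ (y′ ∷ m) _ _ (cong proj₁ T≡)) (reverse≢self (Unique-++⁻ˡ (v ∷ v′ ∷ b) unique))

  first-step : ∀ {x y q} → Valid (x ∷ y ∷ q) → y ≢ s × Adjacent x y × x ≢ y
  first-step ((_ ∷ s≢y ∷ _) ∷ (x≢y ∷ _) ∷ _ , xy ∷ _ , _) = s≢y ∘ sym , xy , x≢y

  -- By `fixed⇒` only the second node of the path can give a fixed pair, and it does so exactly when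
  -- the head is in `V`.
  fixed-count : ∀ {p} → Valid p → ∑ (λ y → inside p y ∧ does (τ (p , y) ≟ₛ (p , y))) ≡ headIn p
  fixed-count {p} valid with atLeastTwo valid
  ... | x , y , q , refl = trans (∑-single y others) at-y
    where
    xyq = x ∷ y ∷ q
    others : ∀ {z} → z ≢ y → inside xyq z ∧ does (τ (xyq , z) ≟ₛ (xyq , z)) ≡ false
    others {z} z≢y with inside xyq z in i
    ... | false = refl
    ... | true  = dec-false (τ (xyq , z) ≟ₛ (xyq , z)) (λ fixed → z≢y (proj₁ (fixed⇒ (valid , i) fixed)))

    inside-y : inside xyq y ≡ true
    inside-y = inside⁺ {xyq} (proj₁ (first-step valid)) (proj₁ (proj₂ (first-step valid)))

    at-y : inside xyq y ∧ does (τ (xyq , y) ≟ₛ (xyq , y)) ≡ V x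
    at-y with V x in x∈V
    ... | true  = cong₂ _∧_ inside-y (dec-true (τ (xyq , y) ≟ₛ (xyq , y))
                    (Move⇒τ (rotate {x ∷ []} refl refl y∉ y∉ (cong not x∈V) (cong not x∈V))))
      where
      y∉ : y ∉ x ∷ []
      y∉ (here y≡x) = proj₂ (proj₂ (first-step valid)) (sym y≡x)
    ... | false = cong₂ _∧_ inside-y (dec-false (τ (xyq , y) ≟ₛ (xyq , y)) (λ fixed → V-x (proj₂ (fixed⇒ (valid , inside-y) fixed))))
      where
      V-x : V x ≢ true
      V-x eq with () ← trans (sym eq) x∈V

  -- The whole row of `a` at the head sums to its degree; setting `s` aside removes the entry
  -- `leadsTo p s`.
  inside-count : ∀ p → Valid p → ∑ (inside p) ≡ headIn p xor leadsTo p s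
  inside-count p valid with atLeastTwo valid
  ... | e , _ , _ , refl = begin
    ∑ (λ y → not (does (y ≟ s)) ∧ a e y)
      ≡⟨ ∑-cong (λ y → split (does (y ≟ s)) (a e y)) ⟩
    ∑ (λ y → a e y xor (does (y ≟ s) ∧ a e y))
      ≡⟨ ⨁-xor (allFin n) (a e) _ ⟩
    ∑ (a e) xor ∑ (λ y → does (y ≟ s) ∧ a e y)
      ≡⟨ cong₂ _xor_ (a-degree e) (∑-δ (a e) s) ⟩
    V e xor a e s ∎
    where
    open ≡-Reasoning
    split : ∀ d b → not d ∧ b ≡ b xor (d ∧ b)
    split true  b = sym (xor-same b)
    split false b = sym (xor-identityʳ b)

  -- Counting the pairs modulo 2

  paths : List (List (Fin n))
  paths = filter valid? (listsUpTo n n)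

  paths-unique : Unique paths
  paths-unique = filter⁺ valid? (listsUpTo-unique n n)

  ∈-paths⁺ : ∀ {p} → Valid p → p ∈ paths
  ∈-paths⁺ valid@(_ ∷ unique , _) = ∈-filter⁺ valid? (∈-listsUpTo (Unique⇒length≤ unique)) valid

  ∈-paths⁻ : ∀ {p} → p ∈ paths → Valid p
  ∈-paths⁻ p∈ = proj₂ (∈-filter⁻ valid? {xs = listsUpTo n n} p∈)

  inside? : ∀ (S : State) → Dec (inside (proj₁ S) (proj₂ S) ≡ true)
  inside? (p , y) = inside p y Bool.≟ true

  states : List State
  states = filter inside? (cartesianProduct paths (allFin n))

  states-unique : Unique states
  states-unique = filter⁺ inside? (cartesianProduct⁺ paths-unique (allFin⁺ n))

  ∈-states⁺ : ∀ {S} → ValidState S → S ∈ states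
  ∈-states⁺ (valid , in≡) = ∈-filter⁺ inside? (∈-cartesianProduct⁺ (∈-paths⁺ valid) (∈-allFin _)) in≡

  ∈-states⁻ : ∀ {S} → S ∈ states → ValidState S
  ∈-states⁻ S∈ with S∈× , in≡ ← ∈-filter⁻ inside? {xs = cartesianProduct paths (allFin n)} S∈ =
    ∈-paths⁻ (proj₁ (∈-cartesianProduct⁻ paths (allFin n) S∈×)) , in≡

  τ-involutive : ∀ {S} → S ∈ states → τ S ∈ states × τ (τ S) ≡ S
  τ-involutive S∈ with step (∈-states⁻ S∈)
  ... | T , move , valid rewrite Move⇒τ move = ∈-states⁺ valid , Move⇒τ (Move-sym move)

  ⨁-states : ∀ f → ⨁ states f ≡ ⨁ paths (λ p → ∑ (λ y → inside p y ∧ f (p , y)))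
  ⨁-states f = trans (⨁-filter inside? (cartesianProduct paths (allFin n)) f)
    (trans (⨁-cartesianProduct paths (allFin n) _)
           (⨁-cong paths λ {p} _ → ∑-cong λ y → cong (_∧ f (p , y)) (does-≟true (inside p y))))
    where
    does-≟true : ∀ b → does (b Bool.≟ true) ≡ b
    does-≟true true  = refl
    does-≟true false = refl

  -- The number of valid states is computed twice. By degrees, a path contributes
  -- `headIn p xor leadsTo p s`; by fixed points of `τ`, it contributes `headIn p`, which cancels.
  even-closing : ⨁ paths (λ p → leadsTo p s) ≡ false
  even-closing = cancel (⨁ paths headIn) (begin
    ⨁ paths headIn xor ⨁ paths (λ p → leadsTo p s)
      ≡⟨ ⨁-xor paths headIn _ ⟨
    ⨁ paths (λ p → headIn p xor leadsTo p s)
      ≡⟨ ⨁-cong paths (λ {p} p∈ → sym (trans (∑-cong (λ y → ∧-identityʳ (inside p y))) (inside-count p (∈-paths⁻ p∈)))) ⟩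
    ⨁ paths (λ p → ∑ (λ y → inside p y ∧ true))
      ≡⟨ ⨁-states (λ _ → true) ⟨
    ⨁ states (λ _ → true)
      ≡⟨ ⨁-involution _≟ₛ_ τ states-unique τ-involutive ⟩
    ⨁ states (λ S → does (τ S ≟ₛ S))
      ≡⟨ ⨁-states (λ S → does (τ S ≟ₛ S)) ⟩
    ⨁ paths (λ p → ∑ (λ y → inside p y ∧ does (τ (p , y) ≟ₛ (p , y))))
      ≡⟨ ⨁-cong paths (λ p∈ → fixed-count (∈-paths⁻ p∈)) ⟩
    ⨁ paths headIn ∎)
    where
    open ≡-Reasoning
    cancel : ∀ b {c} → b xor c ≡ b → c ≡ false
    cancel true  {false} _ = refl
    cancel false {false} _ = refl

  another : ∀ {p₀} → Valid p₀ → leadsTo p₀ s ≡ true → ∃[ p ] Valid p × leadsTo p s ≡ true × p ≢ p₀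
  another {p₀} valid₀ closes₀
    with Any.any? (λ p → (leadsTo p s Bool.≟ true) ×-dec ¬? (≡-dec _≟_ p p₀)) paths
  ... | yes any with p , p∈ , closes , p≢ ← find any = p , ∈-paths⁻ p∈ , closes , p≢
  -- Were `p₀` the only closing path, the even sum would reduce to its term at `p₀`, which is true.
  ... | no ∄ with () ← trans (sym closes₀) (trans (sym (⨁-single paths-unique (∈-paths⁺ valid₀)
                λ p∈ p≢ → ¬-not λ closes → ∄ (lose p∈ (closes , p≢)))) even-closing)

-- Cycles

∈-zip⁻ : ∀ (xs ys : List A) {x y} → (x , y) ∈ zip xs ys → x ∈ xs × y ∈ ys
∈-zip⁻ (x ∷ xs) (y ∷ ys) (here refl) = here refl , here refl
∈-zip⁻ (x ∷ xs) (y ∷ ys) (there e)   = let x∈ , y∈ = ∈-zip⁻ xs ys e in there x∈ , there y∈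

zip-swap : ∀ (xs ys : List A) {x y} → (x , y) ∈ zip xs ys → (y , x) ∈ zip ys xs
zip-swap (x ∷ xs) (y ∷ ys) (here refl) = here refl
zip-swap (x ∷ xs) (y ∷ ys) (there e)   = there (zip-swap xs ys e)

zip-functional : ∀ {xs ys : List A} → Unique xs → ∀ {x y y′} → (x , y) ∈ zip xs ys → (x , y′) ∈ zip xs ys → y ≡ y′
zip-functional {xs = x ∷ xs} {y ∷ ys} (x∉ ∷ u) (here refl) (here refl) = refl
zip-functional {xs = x ∷ xs} {y ∷ ys} (x∉ ∷ u) (here refl) (there e) =
  contradiction refl (All.lookup x∉ (proj₁ (∈-zip⁻ xs ys e)))
zip-functional {xs = x ∷ xs} {y ∷ ys} (x∉ ∷ u) (there e)   (here refl) =
  contradiction refl (All.lookup x∉ (proj₁ (∈-zip⁻ xs ys e)))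
zip-functional {xs = x ∷ xs} {y ∷ ys} (x∉ ∷ u) (there e)   (there e′)  = zip-functional u e e′

zip-total : ∀ {xs ys : List A} → length xs ≡ length ys → ∀ {x} → x ∈ xs → ∃[ y ] (x , y) ∈ zip xs ys
zip-total {xs = x ∷ xs} {y ∷ ys} len (here refl) = y , here refl
zip-total {xs = x ∷ xs} {y ∷ ys} len (there x∈)  =
  let z , e = zip-total (suc-injective len) x∈ in z , there e

zip-degree : ∀ {n} {xs ys : List (Fin n)} → Unique xs → length xs ≡ length ys → ∀ x →
             ∑ (λ y → does ((x , y) ∈²? zip xs ys)) ≡ does (x ∈? xs)
zip-degree {xs = xs} {ys} u len x with x ∈? xs
... | no x∉  = ⨁-zero (allFin _) λ {y} _ → dec-false ((x , y) ∈²? zip xs ys) (x∉ ∘ proj₁ ∘ ∈-zip⁻ xs ys)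
... | yes x∈ with z , e ← zip-total {ys = ys} len x∈ =
  trans (∑-single z λ {y} y≢z → dec-false ((x , y) ∈²? zip xs ys) λ e′ → y≢z (zip-functional u e′ e))
        (dec-true ((x , z) ∈²? zip xs ys) e)

-- After the first step no target is `x` again, because the remaining targets are later nodes of the
-- path or `z`.
path-asym : ∀ x xs {z : A} → Unique (x ∷ xs) → z ∉ x ∷ xs → ∀ {c d} →
            (c , d) ∈ zip (x ∷ xs) (xs ∷ʳ z) → (d , c) ∉ zip (x ∷ xs) (xs ∷ʳ z)
path-asym x []            _        z∉ (here refl) (here refl) = z∉ (here refl)
path-asym x (x′ ∷ xs) {z} (x∉ ∷ u) z∉ = asym
  where
  x∉targets : x ∉ xs ∷ʳ z
  x∉targets x∈ with ∈-++⁻ xs x∈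
  ... | inj₁ x∈xs        = All.lookup x∉ (there x∈xs) refl
  ... | inj₂ (here refl) = z∉ (here refl)

  asym : ∀ {c d} → (c , d) ∈ zip (x ∷ x′ ∷ xs) (x′ ∷ xs ∷ʳ z) → (d , c) ∉ zip (x ∷ x′ ∷ xs) (x′ ∷ xs ∷ʳ z)
  asym (here refl) (here refl) = All.head x∉ refl
  asym (here refl) (there e)   = x∉targets (proj₂ (∈-zip⁻ (x′ ∷ xs) _ e))
  asym (there e)   (here refl) = x∉targets (proj₂ (∈-zip⁻ (x′ ∷ xs) _ e))
  asym (there e)   (there e′)  = path-asym x′ xs u (z∉ ∘ there) e e′

∈-zip-last : ∀ (x : A) xs {t z} → last (x ∷ xs) ≡ just t → (t , z) ∈ zip (x ∷ xs) (xs ∷ʳ z)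
∈-zip-last x []        refl = here refl
∈-zip-last x (x′ ∷ xs) eq   = there (∈-zip-last x′ xs eq)

last-∷ : ∀ (x : A) xs → ∃[ t ] last (x ∷ xs) ≡ just t
last-∷ x []        = x , refl
last-∷ x (x′ ∷ xs) = last-∷ x′ xs

module _ {R : A → A → Set} where

  -- The final target `z` is kept separate from the head so that the induction can drop nodes from
  -- the front.
  closedWalk⇒steps : ∀ {x xs t z} → Linked R (x ∷ xs) → last (x ∷ xs) ≡ just t → R t z →
                     ∀ {c d} → (c , d) ∈ zip (x ∷ xs) (xs ∷ʳ z) → R c d
  closedWalk⇒steps {xs = []}    _       refl r (here refl) = r
  closedWalk⇒steps {xs = _ ∷ _} (r ∷ _) _    _ (here refl) = r
  closedWalk⇒steps {xs = _ ∷ _} (_ ∷ l) eq   r (there e)   = closedWalk⇒steps l eq r e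

  steps⇒Linked : ∀ {x xs z} → (∀ {c d} → (c , d) ∈ zip (x ∷ xs) (xs ∷ʳ z) → R c d) → Linked R (x ∷ xs)
  steps⇒Linked {xs = []}    r = [-]
  steps⇒Linked {xs = _ ∷ _} r = r (here refl) ∷ steps⇒Linked (r ∘ there)

module _ {n} (C : Cycle n) where

  targets-unique : Unique (rest C ∷ʳ first C)
  targets-unique = Unique-resp-↭ (∷↭∷ʳ (first C) (rest C)) (distinct C)

  next-functional : ∀ {x y y′} → (x , y) ∈ steps C → (x , y′) ∈ steps C → y ≡ y′
  next-functional = zip-functional (distinct C)

  previous-functional : ∀ {x x′ y} → (x , y) ∈ steps C → (x′ , y) ∈ steps C → x ≡ x′
  previous-functional e e′ = zip-functional targets-unique (zip-swap (nodes C) _ e) (zip-swap (nodes C) _ e′)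

-- A cycle of two nodes would run along its edge in both directions, which `long` excludes. With a
-- third node, the first step is not reversed later, and the other steps form a path from `y` to
-- `x`.
steps-asym : ∀ {n} (C : Cycle n) {x y} → (x , y) ∈ steps C → (y , x) ∉ steps C
steps-asym record { rest = [] ; long = s≤s () }
steps-asym record { rest = _ ∷ [] ; long = s≤s (s≤s ()) }
steps-asym {n} record { first = x ; rest = y ∷ z ∷ zs ; distinct = x∉ ∷ u@(y∉ ∷ _) } = asym
  where
  no-return : (y , x) ∉ zip (y ∷ z ∷ zs) (z ∷ zs ∷ʳ x)
  no-return (here refl) = All.head (All.tail x∉) refl
  no-return (there e)   = All.lookup y∉ (proj₁ (∈-zip⁻ (z ∷ zs) _ e)) refl

  asym : ∀ {c d} → (c , d) ∈ zip (x ∷ y ∷ z ∷ zs) (y ∷ z ∷ zs ∷ʳ x) →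
         (d , c) ∉ zip (x ∷ y ∷ z ∷ zs) (y ∷ z ∷ zs ∷ʳ x)
  asym (here refl) (here refl) = All.head x∉ refl
  asym (here refl) (there e)   = no-return e
  asym (there e)   (here refl) = no-return e
  asym (there e)   (there e′)  = path-asym y (z ∷ zs) u (λ x∈ → All.lookup x∉ x∈ refl) e e′

xor-true : ∀ {P : Set} (P? : Dec P) {b} → does P? xor b ≡ true → P ⊎ b ≡ true
xor-true (yes p) _  = inj₁ p
xor-true (no _)  eq = inj₂ eq

-- A node of the cycle has one successor and one predecessor. They differ by `steps-asym`, so `∨`
-- becomes `xor` and the two equal counts cancel.
cycle-degree : ∀ {n} (C : Cycle n) x → ∑ (λ y → does (adj? (cycleGraph C) x y)) ≡ false
cycle-degree C x = begin
  ∑ (λ y → does ((x , y) ∈²? steps C) ∨ does ((y , x) ∈²? steps C))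
    ≡⟨ ∑-cong disjoint ⟩
  ∑ (λ y → does ((x , y) ∈²? steps C) xor does ((y , x) ∈²? steps C))
    ≡⟨ ⨁-xor (allFin _) (λ y → does ((x , y) ∈²? steps C)) _ ⟩
  ∑ (λ y → does ((x , y) ∈²? steps C)) xor ∑ (λ y → does ((y , x) ∈²? steps C))
    ≡⟨ cong₂ _xor_ out into ⟩
  does (x ∈? nodes C) xor does (x ∈? nodes C)
    ≡⟨ xor-same (does (x ∈? nodes C)) ⟩
  false ∎
  where
  open ≡-Reasoning
  targets = rest C ∷ʳ first C

  same-length : length (nodes C) ≡ length targets
  same-length = sym (trans (length-++ (rest C)) (+-comm (length (rest C)) 1))

  disjoint : ∀ y → does ((x , y) ∈²? steps C) ∨ does ((y , x) ∈²? steps C)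
                 ≡ does ((x , y) ∈²? steps C) xor does ((y , x) ∈²? steps C)
  disjoint y with (x , y) ∈²? steps C | (y , x) ∈²? steps C
  ... | yes e | yes e′ = contradiction e′ (steps-asym C e)
  ... | yes _ | no _   = refl
  ... | no _  | _      = refl

  out : ∑ (λ y → does ((x , y) ∈²? steps C)) ≡ does (x ∈? nodes C)
  out = zip-degree {ys = targets} (distinct C) same-length x

  into : ∑ (λ y → does ((y , x) ∈²? steps C)) ≡ does (x ∈? nodes C)
  into = begin
    ∑ (λ y → does ((y , x) ∈²? steps C))
      ≡⟨ ∑-cong (λ y → does-cong ((y , x) ∈²? steps C) ((x , y) ∈²? zip targets (nodes C))
           (zip-swap (nodes C) targets) (zip-swap targets (nodes C))) ⟩
    ∑ (λ y → does ((x , y) ∈²? zip targets (nodes C)))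
      ≡⟨ zip-degree {ys = nodes C} (targets-unique C) (sym same-length) x ⟩
    does (x ∈? targets)
      ≡⟨ does-cong (x ∈? targets) (x ∈? nodes C)
           (∈-resp-↭ (↭-sym (∷↭∷ʳ (first C) (rest C)))) (∈-resp-↭ (∷↭∷ʳ (first C) (rest C))) ⟩
    does (x ∈? nodes C) ∎

-- Two cycles that share an oriented step and the edges of C are traversed in unison.
module _ {n} (C D : Cycle n) (C⊆D : cycleGraph C ⊆ᴳ cycleGraph D) where

  -- The edge between `y` and `z` also belongs to `D`. If `D` ran it from `z` to `y`, then `z` would
  -- be the predecessor `x` of `y`, and `C` would turn straight back.
  same-next : ∀ {x y z z′} → (x , y) ∈ steps C → (y , z) ∈ steps C →
              (x , y) ∈ steps D → (y , z′) ∈ steps D → z ≡ z′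
  same-next xyC yzC xyD yz′D with C⊆D (inj₁ yzC)
  ... | inj₁ yzD = next-functional D yzD yz′D
  ... | inj₂ zyD with refl ← previous-functional D zyD xyD = contradiction yzC (steps-asym C xyC)

  -- Here `z` is the common starting node. Both lists are followed by `z` and avoid it, so equal
  -- successors force them to end together.
  same-rest : ∀ {x y r r′ z} → (x , y) ∈ steps C → (x , y) ∈ steps D →
              (∀ {e} → e ∈ zip (y ∷ r) (r ∷ʳ z) → e ∈ steps C) →
              (∀ {e} → e ∈ zip (y ∷ r′) (r′ ∷ʳ z) → e ∈ steps D) →
              z ∉ r → z ∉ r′ → r ≡ r′
  same-rest {r = []}    {[]}    xyC xyD stepsC stepsD z∉r z∉r′ = refl
  same-rest {r = []}    {_ ∷ _} xyC xyD stepsC stepsD z∉r z∉r′ =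
    contradiction (here (same-next xyC (stepsC (here refl)) xyD (stepsD (here refl)))) z∉r′
  same-rest {r = _ ∷ _} {[]}    xyC xyD stepsC stepsD z∉r z∉r′ =
    contradiction (here (sym (same-next xyC (stepsC (here refl)) xyD (stepsD (here refl))))) z∉r
  same-rest {r = _ ∷ _} {_ ∷ _} xyC xyD stepsC stepsD z∉r z∉r′
    with refl ← same-next xyC (stepsC (here refl)) xyD (stepsD (here refl)) =
    cong (_ ∷_) (same-rest (stepsC (here refl)) (stepsD (here refl))
      (stepsC ∘ there) (stepsD ∘ there) (z∉r ∘ there) (z∉r′ ∘ there))

-- The shared step from `t` to the first node fixes the orientation and starts the induction of
-- `same-rest`, which applies once every edge of `C` is an edge of `D`.
differ : ∀ {n} (C D : Cycle n) {t} → first C ≡ first D → rest C ≢ rest D →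
         (t , first C) ∈ steps C → (t , first C) ∈ steps D → DifferInAnEdge C D
differ C D refl r≢r′ tsC tsD
  with any? (λ x → any? (λ y → adj? (cycleGraph C) x y ×-dec ¬? (adj? (cycleGraph D) x y)))
... | yes (x , y , xyC , xy∉D) = x , y , inj₁ (xyC , xy∉D)
... | no ∄ = contradiction (same-rest C D C⊆D tsC tsD id id (first∉rest C) (first∉rest D)) r≢r′
  where
  C⊆D : cycleGraph C ⊆ᴳ cycleGraph D
  C⊆D {x} {y} xyC = decidable-stable (adj? (cycleGraph D) x y) (λ xy∉D → ∄ (x , y , xyC , xy∉D))

  first∉rest : ∀ C → first C ∉ rest C
  first∉rest C = Unique[x∷xs]⇒x∉xs (distinct C)

-- From degree parities to a second cycle

secondCycle : ∀ {n} (V : Fin n → Bool) (a : Fin n → Fin n → Bool)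
  (a-sym : ∀ x y → a x y ≡ a y x) (a-irrefl : ∀ x → a x x ≡ false) (a-degree : ∀ x → ∑ (a x) ≡ V x)
  (H : Cycle n) → (∀ {x y} → (x , y) ∈ steps H → a x y ≡ true) → (∀ x → x ∈ nodes H ⇔ V x ≡ true) →
  ∃[ D ] (∀ {x y} → (x , y) ∈ steps D → a x y ≡ true) × (∀ x → V x ≡ true → x ∈ nodes D) × DifferInAnEdge H D
secondCycle V a _ _ _ record { rest = [] ; long = s≤s () }
secondCycle V a _ _ _ record { rest = _ ∷ [] ; long = s≤s (s≤s ()) }
secondCycle {n} V a a-sym a-irrefl a-degree
  H@record { first = s ; rest = p₀@(u ∷ w ∷ q₀) ; distinct = H-distinct@(s∉ ∷ u∉ ∷ _) } a-step nodes⇔V =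
  -- The path `p₀` closes because the first step of `H` joins `s` to its head `u`.
  conclude (L.another p₀-valid (trans (a-sym u s) (a-step (here refl))))
  where
  t = proj₁ (last-∷ u (w ∷ q₀))
  last-p₀ = proj₂ (last-∷ u (w ∷ q₀))

  ts∈H : (t , s) ∈ steps H
  ts∈H = there (∈-zip-last u (w ∷ q₀) last-p₀)

  ∈V : ∀ {x} → x ∈ nodes H → V x ≡ true
  ∈V = Equivalence.to (nodes⇔V _)

  -- The second and third nodes of `H` serve as the two nodes of `V` other than `s`.
  module L = Lollipop V a a-sym a-irrefl a-degree s t u w (All.head u∉)
    (∈V (there (here refl)) , All.head s∉ ∘ sym)
    (∈V (there (there (here refl))) , All.head (All.tail s∉) ∘ sym)

  p₀-valid : L.Valid p₀
  p₀-valid = H-distinct , steps⇒Linked (a-step ∘ there) , last-p₀ , covers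
    where
    covers : ∀ v → V v ≡ true × v ≢ s → v ∈ p₀
    covers v (v∈V , v≢s) with Equivalence.from (nodes⇔V v) v∈V
    ... | here v≡s   = contradiction v≡s v≢s
    ... | there v∈p₀ = v∈p₀

  conclude : ∃[ p ] L.Valid p × L.leadsTo p s ≡ true × p ≢ p₀ →
    ∃[ D ] (∀ {x y} → (x , y) ∈ steps D → a x y ≡ true) × (∀ x → V x ≡ true → x ∈ nodes D) × DifferInAnEdge H D
  conclude (p , valid@(unique , linked , last-p , cover) , closes , p≢p₀) with L.atLeastTwo valid
  ... | x , _ , _ , refl =
    -- The new cycle returns to `s` by the last step of `H`, which is therefore common to both
    -- cycles.
    D , closedWalk⇒steps (trans (a-sym s x) closes ∷ linked) last-p (a-step ts∈H) , D-covers ,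
    differ H D refl (p≢p₀ ∘ sym) ts∈H (∈-zip-last s p last-p)
    where
    D : Cycle n
    D = record { first = s ; rest = p ; distinct = unique ; long = s≤s (s≤s (s≤s z≤n)) }

    D-covers : ∀ x → V x ≡ true → x ∈ nodes D
    D-covers x x∈V with x ≟ s
    ... | yes x≡s = here x≡s
    ... | no x≢s  = there (cover x (x∈V , x≢s))

-- Application to the union of the cycle and the forest

lemma2p13 : ∀ {n : ℕ} (V U : Subset n) (E : Graph n) (H : Cycle n) →
    IsBipartite V U E →
    IsForest E →
    (∀ (T : Subset n) → IsComponent E T → EvenlyMany (V ∩ T)) →
    IsHamiltonianCycleOn (cycleGraph H ∪ᴳ E) V H →
    ∣ V ∣ < 24 →
    HasSecondHamiltonianCycle (cycleGraph H ∪ᴳ E) V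
lemma2p13 {n} V U E H bipartite _ even ham@(_ , nodes⇔V) _ =
  conclude (secondCycle (lookup V) a a-sym a-irrefl a-degree H a-step
    (λ x → mk⇔ ([]=⇒lookup ∘ Equivalence.to (nodes⇔V x)) (Equivalence.from (nodes⇔V x) ∘ lookup⇒[]= x V)))
  where
  open Join (join V E even)
  G = cycleGraph H ∪ᴳ E

  h? : ∀ x y → Dec (Adj (cycleGraph H) x y)
  h? = adj? (cycleGraph H)

  -- The symmetric difference of `H` and the join: `H` has even degree everywhere, so the degree
  -- parities are those of `J`.
  a : Fin n → Fin n → Bool
  a x y = does (h? x y) xor J x y

  a⇒Adj : ∀ {x y} → a x y ≡ true → Adj G x y
  a⇒Adj {x} {y} eq = Sum.map₂ J⊆ (xor-true (h? x y) eq)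

  a-sym : ∀ x y → a x y ≡ a y x
  a-sym x y = cong₂ _xor_ (does-cong (h? x y) (h? y x) (adj-sym (cycleGraph H)) (adj-sym (cycleGraph H))) (J-sym x y)

  a-irrefl : ∀ x → a x x ≡ false
  a-irrefl x = ¬-not (adj-irrefl G ∘ a⇒Adj {x} {x})

  a-degree : ∀ x → ∑ (a x) ≡ lookup V x
  a-degree x = trans (⨁-xor (allFin n) (λ y → does (h? x y)) (J x)) (cong₂ _xor_ (cycle-degree H x) (degree x))

  -- Edges of `J` belong to `E` and run between `V` and `U`, while `H` visits only `V`. Hence no
  -- edge of `H` is cancelled in `a`.
  ∉J : ∀ {x y} → x ∈ nodes H → y ∈ nodes H → J x y ≡ false
  ∉J {x} {y} x∈ y∈ = ¬-not λ eq → [ (λ (_ , y∈U) → ∉U y∈ y∈U) , (λ (x∈U , _) → ∉U x∈ x∈U) ] (across (J⊆ eq))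
    where
    open IsBipartite bipartite
    ∉U : ∀ {z} → z ∈ nodes H → ¬ z ∈ˢ U
    ∉U z∈ z∈U = ∉⊥ (subst (_ ∈ˢ_) disjoint (x∈p∩q⁺ (Equivalence.to (nodes⇔V _) z∈ , z∈U)))

  a-step : ∀ {x y} → (x , y) ∈ steps H → a x y ≡ true
  a-step {x} {y} e = let x∈ , y∈ = ∈-zip⁻ (nodes H) _ e in
    cong₂ _xor_ (dec-true (h? x y) (inj₁ e)) (∉J x∈ (∈-resp-↭ (↭-sym (∷↭∷ʳ (first H) (rest H))) y∈))

  conclude : ∃[ D ] (∀ {x y} → (x , y) ∈ steps D → a x y ≡ true) ×
             (∀ x → lookup V x ≡ true → x ∈ nodes D) × DifferInAnEdge H D →
             HasSecondHamiltonianCycle G V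
  conclude (D , D-steps , D-covers , D≠H) = H , D , ham ,
    ([ a⇒Adj ∘ D-steps , adj-sym G ∘ a⇒Adj ∘ D-steps ] , λ x → D-covers x ∘ []=⇒lookup) , D≠H
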